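{- For every integer $n\geq 3$, the $3$-extra connectivity of the $3$-ary $n$-cube satisfies $\kappa_{3}(Q_{n}^{3})=8n-12$.
   Context: The $3$-ary $n$-cube $Q_n^3$ is the graph whose vertices are the strings $u=u_{n-1}u_{n-2}\cdots u_0$ with $u_i\in\{0,1,2\}$, two vertices $u,v$ being adjacent if and only if there is an index $j$ with $u_j=v_j\pm 1 \pmod 3$ and $u_i=v_i$ for all $i\neq j$. For a connected graph $G$ and an integer $h\geq 0$, a vertex set $S\subseteq V(G)$ is an $h$-extra vertex cut if $G-S$ is disconnected and every component of $G-S$ has at least $h+1$ vertices; the $h$-extra connectivity $\kappa_h(G)$ is the minimum cardinality of an $h$-extra vertex cut of $G$. -}

module Defs where

open import Data.Nat using (ℕ; zero; suc; _+_; _*_; _∸_; _≤_)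
open import Data.Fin using (Fin; zero; suc)
open import Data.Vec using (Vec; lookup)
open import Data.List using (List; []; _∷_; length)
open import Data.List.Membership.Propositional using (_∈_; _∉_)
open import Data.List.Relation.Unary.Unique.Propositional using (Unique)
open import Data.List.Relation.Unary.All using (All)
open import Data.Product using (Σ; _×_; ∃-syntax)
open import Data.Sum using (_⊎_)
open import Relation.Binary.PropositionalEquality using (_≡_; _≢_)
open import Relation.Nullary using (¬_)

Vertex : ℕ → Set
Vertex n = Vec (Fin 3) n

inc3 : Fin 3 → Fin 3
inc3 zero = suc zero
inc3 (suc zero) = suc (suc zero)
inc3 (suc (suc zero)) = zero

_±1≡_ : Fin 3 → Fin 3 → Set
a ±1≡ b = (a ≡ inc3 b) ⊎ (b ≡ inc3 a)

Adj : (n : ℕ) → Vertex n → Vertex n → Set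
Adj n u v = ∃[ j ] ((lookup u j ±1≡ lookup v j) ×
                    (∀ i → i ≢ j → lookup u i ≡ lookup v i))

record VertexSet (n : ℕ) : Set where
  constructor vset
  field
    elems  : List (Vertex n)
    unique : Unique elems
open VertexSet public

∣_∣ᵥ : ∀ {n} → VertexSet n → ℕ
∣ S ∣ᵥ = length (elems S)

data Walk (n : ℕ) (S : VertexSet n) : Vertex n → Vertex n → Set where
  here : ∀ {u} → u ∉ elems S → Walk n S u u
  step : ∀ {u w v} → u ∉ elems S → Adj n u w → Walk n S w v → Walk n S u v

Connected : (n : ℕ) → VertexSet n → Vertex n → Vertex n → Set
Connected n S u v = Walk n S u v

Disconnected : (n : ℕ) → VertexSet n → Set
Disconnected n S =
  ∃[ u ] ∃[ v ] (u ∉ elems S × v ∉ elems S × ¬ Connected n S u v)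

-- every component of Q_n^3 - S has at least h+1 vertices: for every vertex v
-- outside S there are h+1 distinct vertices in the component of v
ComponentsAtLeast : (n h : ℕ) → VertexSet n → Set
ComponentsAtLeast n h S =
  ∀ v → v ∉ elems S →
    ∃[ C ] (Unique C × length C ≡ suc h × All (Connected n S v) C)

IsExtraCut : (n h : ℕ) → VertexSet n → Set
IsExtraCut n h S = Disconnected n S × ComponentsAtLeast n h S

ExtraConnectivityIs : (n h k : ℕ) → Set
ExtraConnectivityIs n h k =
  (∃[ S ] (IsExtraCut n h S × ∣ S ∣ᵥ ≡ k)) ×
  (∀ S → IsExtraCut n h S → k ≤ ∣ S ∣ᵥ)

{-# OPTIONS --safe #-}

-- Lower bound.  Let A be a component of Qₙ − S and B the union of the others,
-- so that A and B are disjoint and not adjacent, and s = 3ⁿ − |A| − |B| ≤ |S|.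
-- By induction on n, if |A|, |B| ≥ m then s ≥ 2n, 4n − 3, 6n − 7, 8n − 12 for
-- m = 1, 2, 3, 4.  Compressing along one coordinate, A towards layer 0 and B
-- towards layer 2, preserves sizes and separation and gives layers with
-- A₀ ⊇ A₁ ⊇ A₂, B₀ ⊆ B₁ ⊆ B₂ and A₀ ∩ B₂ = ∅.  The induction hypothesis for
-- (Aᵢ , Bᵢ), together with s₂ ≥ |A₀| − |A₂|, s₀ ≥ |B₂| − |B₀| and
-- s₀ + s₂ ≥ 3ⁿ − |A₂| − |B₀|, then yields the bound by linear arithmetic.
--
-- Upper bound.  The neighbourhood of the 4-cycle {0,1}² × {0…0} has 8n − 12
-- vertices, and outside it every vertex reaches a translate of the square
-- {0,1}² or of the cross formed by the pairs with an entry 2.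
module Submission where

open import Defs
open import Data.Bool using (Bool; true; false; T; _∨_)
open import Data.Fin using (Fin; zero; suc)
import Data.Fin.Properties as Fin
open import Data.List using ([]; _∷_)
open import Data.Nat
open import Data.Nat.Properties
open import Data.Nat.Tactic.RingSolver using (solve; solve-∀)
open import Data.Product using (∃-syntax; _×_; _,_; proj₁; proj₂)
open import Data.Sum using (_⊎_; inj₁; inj₂)
open import Data.Unit using (tt)
open import Function using (_∘_)
open import Relation.Binary.Definitions using (DecidableEquality)
open import Relation.Binary.PropositionalEquality
open import Relation.Nullary
open import Relation.Nullary.Decidable using (decidable-stable; from-yes)
open import Relation.Unary using (Decidable)

-- Linear inequalities and the four bounds.

-- A Farkas certificate: x ≤ y is a sum of hypotheses and k is the slack.
linear : ∀ {x y l r} k → x ≤ y → r + x ≡ k + (l + y) → l ≤ r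
linear {x} {y} {l} {r} k x≤y e = +-cancelʳ-≤ y l r (begin
  l + y        ≤⟨ m≤n+m (l + y) k ⟩
  k + (l + y)  ≡⟨ e ⟨
  r + x        ≤⟨ +-monoʳ-≤ r x≤y ⟩
  r + y        ∎)
  where open ≤-Reasoning

infixl 4 _⊕_
_⊕_ : ∀ {a b c d} → a ≤ b → c ≤ d → a + c ≤ b + d
_⊕_ = +-mono-≤

split : ∀ k x → x ≤ k ⊎ k < x
split k x = ≤-<-connex x k

-- A 4-cycle, a path on 3 vertices, an edge and a vertex have 8n − 12, 6n − 7,
-- 4n − 3 and 2n neighbours; the constants are moved across to avoid ∸.
record Bounds (n a b s : ℕ) : Set where
  field
    bound₁ : 1 ≤ a → 1 ≤ b → 2 * n ≤ s
    bound₂ : 2 ≤ a → 2 ≤ b → 4 * n ≤ s + 3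
    bound₃ : 3 ≤ a → 3 ≤ b → 6 * n ≤ s + 7
    bound₄ : 4 ≤ a → 4 ≤ b → 8 * n ≤ s + 12
open Bounds

Bounds-sym : ∀ {n a b s} → Bounds n a b s → Bounds n b a s
Bounds-sym B .bound₁ p q = B .bound₁ q p
Bounds-sym B .bound₂ p q = B .bound₂ q p
Bounds-sym B .bound₃ p q = B .bound₃ q p
Bounds-sym B .bound₄ p q = B .bound₄ q p

Bounds-mono : ∀ {n a b s t} → s ≤ t → Bounds n a b s → Bounds n a b t
Bounds-mono s≤t B .bound₁ p q = ≤-trans (B .bound₁ p q) s≤t
Bounds-mono s≤t B .bound₂ p q = ≤-trans (B .bound₂ p q) (+-monoˡ-≤ 3 s≤t)
Bounds-mono s≤t B .bound₃ p q = ≤-trans (B .bound₃ p q) (+-monoˡ-≤ 7 s≤t)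
Bounds-mono s≤t B .bound₄ p q = ≤-trans (B .bound₄ p q) (+-monoˡ-≤ 12 s≤t)

-- The size of a layer.

-- All that is used of N = 3 ^ n.
record Size (n N : ℕ) : Set where
  field
    1≤n    : 1 ≤ n
    size₁  : 2 * n + 1 ≤ N
    size₂  : 4 * n ≤ N + 1
    size₃  : 6 * n ≤ N + 3
    size₄  : 8 * n ≤ N + 7
    small₁ : n ≤ 1 ⊎ 4 * n ≤ N
    small₂ : n ≤ 2 ⊎ 8 * n + 3 ≤ N

-- The one inequality `8 * n + 3 ≤ N` yields every estimate on `N`; dimensions 1 and 2 are left to
-- computation in `3^-size`.
large : ∀ n N → 3 ≤ n → 8 * n + 3 ≤ N → Size n N
large n N 3≤n big = record
  { 1≤n    = linear 2 3≤n (solve (n ∷ []))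
  ; size₁  = linear (6 * n + 2) big (solve (n ∷ N ∷ []))
  ; size₂  = linear (4 * n + 4) big (solve (n ∷ N ∷ []))
  ; size₃  = linear (2 * n + 6) big (solve (n ∷ N ∷ []))
  ; size₄  = linear 10 big (solve (n ∷ N ∷ []))
  ; small₁ = inj₂ (linear (4 * n + 3) big (solve (n ∷ N ∷ [])))
  ; small₂ = inj₂ big
  }

3^-large : ∀ k → 8 * (3 + k) + 3 ≤ 3 ^ (3 + k)
-- Equality: both sides are 27.
3^-large zero    = ≤-refl
3^-large (suc k) = grow (3 ^ (3 + k)) (3^-large k)
  where
  grow : ∀ N → 8 * (3 + k) + 3 ≤ N → 8 * (4 + k) + 3 ≤ 3 * N
  grow N h = linear (16 * k + 46) (h ⊕ h ⊕ h) (solve (k ∷ N ∷ []))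

3^-size : ∀ n → Size (suc n) (3 ^ suc n)
3^-size 0 = record
  { 1≤n = ≤ᵇ⇒≤ _ _ tt ; size₁ = ≤ᵇ⇒≤ _ _ tt ; size₂ = ≤ᵇ⇒≤ _ _ tt
  ; size₃ = ≤ᵇ⇒≤ _ _ tt ; size₄ = ≤ᵇ⇒≤ _ _ tt
  ; small₁ = inj₁ (≤ᵇ⇒≤ _ _ tt) ; small₂ = inj₁ (≤ᵇ⇒≤ _ _ tt) }
3^-size 1 = record
  { 1≤n = ≤ᵇ⇒≤ _ _ tt ; size₁ = ≤ᵇ⇒≤ _ _ tt ; size₂ = ≤ᵇ⇒≤ _ _ tt
  ; size₃ = ≤ᵇ⇒≤ _ _ tt ; size₄ = ≤ᵇ⇒≤ _ _ tt
  ; small₁ = inj₂ (≤ᵇ⇒≤ _ _ tt) ; small₂ = inj₁ (≤ᵇ⇒≤ _ _ tt) }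
3^-size (suc (suc k)) = large (3 + k) (3 ^ (3 + k)) (s≤s (s≤s (s≤s z≤n))) (3^-large k)

-- The induction step as arithmetic on three layers.

-- aᵢ, bᵢ and sᵢ are the numbers of vertices of A, of B and of the rest in
-- layer i of the compressed configuration, and N is the size of a layer.
record Layers (n N a₀ a₁ a₂ b₀ b₁ b₂ s₀ s₁ s₂ : ℕ) : Set where
  field
    a₁≤a₀   : a₁ ≤ a₀
    a₂≤a₁   : a₂ ≤ a₁
    b₀≤b₁   : b₀ ≤ b₁
    b₁≤b₂   : b₁ ≤ b₂
    layer₀  : Bounds n a₀ b₀ s₀
    layer₁  : Bounds n a₁ b₁ s₁
    layer₂  : Bounds n a₂ b₂ s₂
    outer   : N ≤ s₀ + s₂ + (a₂ + b₀)
    a₀≤s₂   : a₀ ≤ s₂ + a₂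
    b₂≤s₀   : b₂ ≤ s₀ + b₀
    a₀≤s₁   : a₀ ≤ s₁ + a₁
    b₂≤s₁   : b₂ ≤ s₁ + b₁

-- Exchanging A with B and reversing the layers turns the case `a₂ ≥ 1`, `b₀ = 0` into the case
-- `a₂ = 0`, `b₀ ≥ 1`.
flip : ∀ {n N a₀ a₁ a₂ b₀ b₁ b₂ s₀ s₁ s₂} →
       Layers n N a₀ a₁ a₂ b₀ b₁ b₂ s₀ s₁ s₂ → Layers n N b₂ b₁ b₀ a₂ a₁ a₀ s₂ s₁ s₀
flip {N = N} {a₂ = a₂} {b₀ = b₀} {s₀ = s₀} {s₂ = s₂} L = record
  { a₁≤a₀ = b₁≤b₂ ; a₂≤a₁ = b₀≤b₁ ; b₀≤b₁ = a₂≤a₁ ; b₁≤b₂ = a₁≤a₀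
  ; layer₀ = Bounds-sym layer₂ ; layer₁ = Bounds-sym layer₁ ; layer₂ = Bounds-sym layer₀
  ; outer = subst (N ≤_) (cong₂ _+_ (+-comm s₀ s₂) (+-comm a₂ b₀)) outer
  ; a₀≤s₂ = b₂≤s₀ ; b₂≤s₀ = a₀≤s₂ ; a₀≤s₁ = b₂≤s₁ ; b₂≤s₁ = a₀≤s₁ }
  where open Layers L

2≤max : ∀ x y z → x ≤ y → y ≤ z → 4 ≤ x + y + z → 2 ≤ z
2≤max x y z x≤y y≤z p with split 1 z
... | inj₂ q = q
-- If `z ≤ 1`, then 4 ≤ x + y + z ≤ 3z ≤ 3; the certificate derives `1 ≤ 0`.
... | inj₁ q with () ← linear {l = 1} {r = 0} 0 (p ⊕ x≤y ⊕ y≤z ⊕ y≤z ⊕ q ⊕ q ⊕ q)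
                         (solve (x ∷ y ∷ z ∷ []))

sum-reverse : ∀ x y z → x + y + z ≡ z + y + x
sum-reverse = solve-∀

module Step {n N a₀ a₁ a₂ b₀ b₁ b₂ s₀ s₁ s₂ : ℕ}
            (size : Size n N) (L : Layers n N a₀ a₁ a₂ b₀ b₁ b₂ s₀ s₁ s₂) where
  open Size size
  open Layers L

  Goal : Set
  Goal = Bounds (suc n) (a₀ + a₁ + a₂) (b₀ + b₁ + b₂) (s₀ + s₁ + s₂)

  -- Here `outer` alone gives `s₀ + s₂ ≥ N`. Layer 1 supplies the rest: either it meets both sets,
  -- or one set fills a single outer layer and, by `a₀≤s₁` or `b₂≤s₁`, leaves at least its own size
  -- uncovered in layer 1.
  module BothEmpty (p : a₂ ≤ 0) (q : b₀ ≤ 0) where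
    N≤s₀+s₂ : N ≤ s₀ + s₂
    N≤s₀+s₂ = linear 0 (outer ⊕ p ⊕ q) (solve (N ∷ s₀ ∷ s₂ ∷ a₂ ∷ b₀ ∷ []))

    middle : ∀ m → m ≤ a₀ + a₁ + a₂ → m ≤ b₀ + b₁ + b₂ → 2 * n ≤ s₁ ⊎ m ≤ s₁
    middle m α β with split 0 a₁ | split 0 b₁
    ... | inj₂ u | inj₂ v = inj₁ (layer₁ .bound₁ u v)
    ... | inj₁ u | _      = inj₂ (linear 0 (α ⊕ p ⊕ u ⊕ u ⊕ a₀≤s₁)
                                    (solve (m ∷ a₀ ∷ a₁ ∷ a₂ ∷ s₁ ∷ [])))
    ... | _      | inj₁ v = inj₂ (linear 0 (β ⊕ q ⊕ v ⊕ v ⊕ b₂≤s₁)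
                                    (solve (m ∷ b₀ ∷ b₁ ∷ b₂ ∷ s₁ ∷ [])))

    goal : Goal
    goal .bound₁ α β with middle 1 α β
    ... | inj₁ h = linear n (N≤s₀+s₂ ⊕ h ⊕ size₁ ⊕ 1≤n) (solve (n ∷ N ∷ s₀ ∷ s₁ ∷ s₂ ∷ []))
    ... | inj₂ h = linear 0 (N≤s₀+s₂ ⊕ h ⊕ size₁) (solve (n ∷ N ∷ s₀ ∷ s₁ ∷ s₂ ∷ []))
    goal .bound₂ α β with middle 2 α β
    ... | inj₁ h = linear 0 (N≤s₀+s₂ ⊕ h ⊕ size₁) (solve (n ∷ N ∷ s₀ ∷ s₁ ∷ s₂ ∷ []))
    ... | inj₂ h = linear 0 (N≤s₀+s₂ ⊕ h ⊕ size₂) (solve (n ∷ N ∷ s₀ ∷ s₁ ∷ s₂ ∷ []))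
    goal .bound₃ α β with middle 3 α β
    ... | inj₁ h = linear 0 (N≤s₀+s₂ ⊕ h ⊕ size₂) (solve (n ∷ N ∷ s₀ ∷ s₁ ∷ s₂ ∷ []))
    ... | inj₂ h = linear 1 (N≤s₀+s₂ ⊕ h ⊕ size₃) (solve (n ∷ N ∷ s₀ ∷ s₁ ∷ s₂ ∷ []))
    goal .bound₄ α β with middle 4 α β
    ... | inj₁ h = linear 1 (N≤s₀+s₂ ⊕ h ⊕ size₃) (solve (n ∷ N ∷ s₀ ∷ s₁ ∷ s₂ ∷ []))
    ... | inj₂ h = linear 1 (N≤s₀+s₂ ⊕ h ⊕ size₄) (solve (n ∷ N ∷ s₀ ∷ s₁ ∷ s₂ ∷ []))

  -- By the nesting of the layers, every layer meets both sets, so `s₀ + s₁ + s₂ ≥ 6 * n`. This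
  -- settles the first three bounds.
  module BothNonempty (p : 1 ≤ a₂) (q : 1 ≤ b₀) where
    1≤a₁ : 1 ≤ a₁
    1≤a₁ = ≤-trans p a₂≤a₁
    1≤b₁ : 1 ≤ b₁
    1≤b₁ = ≤-trans q b₀≤b₁
    h₀ : 2 * n ≤ s₀
    h₀ = layer₀ .bound₁ (≤-trans 1≤a₁ a₁≤a₀) q
    h₁ : 2 * n ≤ s₁
    h₁ = layer₁ .bound₁ 1≤a₁ 1≤b₁
    h₂ : 2 * n ≤ s₂
    h₂ = layer₂ .bound₁ p (≤-trans 1≤b₁ b₁≤b₂)

    goal : Goal
    goal .bound₁ α β = linear (2 * n) (h₀ ⊕ h₁ ⊕ h₂ ⊕ 1≤n ⊕ 1≤n) (solve (n ∷ s₀ ∷ s₁ ∷ s₂ ∷ []))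
    goal .bound₂ α β = linear n (h₀ ⊕ h₁ ⊕ h₂ ⊕ 1≤n) (solve (n ∷ s₀ ∷ s₁ ∷ s₂ ∷ []))
    goal .bound₃ α β = linear 1 (h₀ ⊕ h₁ ⊕ h₂) (solve (n ∷ s₀ ∷ s₁ ∷ s₂ ∷ []))
    -- The target is 8n - 4, so 6n falls short by 2n - 4. An edge bound in an outer layer adds 2n -
    -- 3, for `n ≤ 2` nothing is missing, and with `a₂` and `b₀` at most 1 `outer` gives
    -- `s₀ + s₂ ≥ N − 2`.
    goal .bound₄ α β with split 1 a₂ | split 1 b₀ | small₂
    ... | inj₂ u | _ | _ =
      linear 1 (h₀ ⊕ h₁ ⊕ layer₂ .bound₂ u (2≤max b₀ b₁ b₂ b₀≤b₁ b₁≤b₂ β))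
        (solve (n ∷ s₀ ∷ s₁ ∷ s₂ ∷ []))
    ... | _ | inj₂ v | _ =
      linear 1 (layer₀ .bound₂ 2≤a₀ v ⊕ h₁ ⊕ h₂) (solve (n ∷ s₀ ∷ s₁ ∷ s₂ ∷ []))
      where
      2≤a₀ : 2 ≤ a₀
      2≤a₀ = 2≤max a₂ a₁ a₀ a₂≤a₁ a₁≤a₀ (subst (4 ≤_) (sum-reverse a₀ a₁ a₂) α)
    ... | _ | _ | inj₁ w =
      linear 0 (h₀ ⊕ h₁ ⊕ h₂ ⊕ w ⊕ w) (solve (n ∷ s₀ ∷ s₁ ∷ s₂ ∷ []))
    ... | inj₁ u | inj₁ v | inj₂ w =
      linear (2 * n + 5) (outer ⊕ u ⊕ v ⊕ h₁ ⊕ w) (solve (n ∷ N ∷ a₂ ∷ b₀ ∷ s₀ ∷ s₁ ∷ s₂ ∷ []))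

  module OneEmpty (p : a₂ ≤ 0) (q : 1 ≤ b₀) where
    a₀≤s₂′ : a₀ ≤ s₂
    a₀≤s₂′ = linear 0 (a₀≤s₂ ⊕ p) (solve (a₀ ∷ a₂ ∷ s₂ ∷ []))

    outer′ : N ≤ s₀ + s₂ + b₀
    outer′ = linear 0 (outer ⊕ p) (solve (N ∷ s₀ ∷ s₂ ∷ a₂ ∷ b₀ ∷ []))

    1≤b₁ : 1 ≤ b₁
    1≤b₁ = ≤-trans q b₀≤b₁

    -- A lies in layer 0, so layers 1 and 2 each have at least `a₀ ≥ m` vertices outside A and B. If
    -- `b₀ ≥ m`, these 2m vertices are exactly the growth of the m-th bound from `n` to `n + 1`. If
    -- `b₀` is smaller, either `outer′` is strong enough or `n` is so small that a weaker bound in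
    -- layer 0 suffices.
    module OneLayer (z : a₁ ≤ 0) where
      below-a₀ : ∀ m → m ≤ a₀ + a₁ + a₂ → m ≤ a₀
      below-a₀ m α = linear 0 (α ⊕ z ⊕ p) (solve (m ∷ a₀ ∷ a₁ ∷ a₂ ∷ []))

      below-s₁+s₂ : ∀ m → m ≤ a₀ → m + m ≤ s₁ + s₂
      below-s₁+s₂ m α = linear 0 (α ⊕ α ⊕ a₀≤s₁ ⊕ z ⊕ a₀≤s₂′) (solve (m ∷ a₀ ∷ a₁ ∷ s₁ ∷ s₂ ∷ []))

      below-s₁ : ∀ m → m ≤ a₀ → m ≤ s₁
      below-s₁ m α = linear 0 (α ⊕ a₀≤s₁ ⊕ z) (solve (m ∷ a₀ ∷ a₁ ∷ s₁ ∷ []))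

      goal : Goal
      goal .bound₁ α β =
        linear 0 (layer₀ .bound₁ (below-a₀ 1 α) q ⊕ below-s₁+s₂ 1 (below-a₀ 1 α))
          (solve (n ∷ s₀ ∷ s₁ ∷ s₂ ∷ []))
      goal .bound₂ α β with split 1 b₀ | small₁
      ... | inj₂ v | _ =
        linear 0 (layer₀ .bound₂ (below-a₀ 2 α) v ⊕ below-s₁+s₂ 2 (below-a₀ 2 α))
          (solve (n ∷ s₀ ∷ s₁ ∷ s₂ ∷ []))
      ... | inj₁ v | inj₁ w =
        linear 1 (layer₀ .bound₁ (≤-trans (s≤s z≤n) (below-a₀ 2 α)) q
                   ⊕ below-s₁+s₂ 2 (below-a₀ 2 α) ⊕ w ⊕ w)
          (solve (n ∷ s₀ ∷ s₁ ∷ s₂ ∷ []))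
      ... | inj₁ v | inj₂ w =
        linear 0 (outer′ ⊕ v ⊕ below-s₁ 2 (below-a₀ 2 α) ⊕ w) (solve (n ∷ N ∷ b₀ ∷ s₀ ∷ s₁ ∷ s₂ ∷ []))
      goal .bound₃ α β with split 1 b₀ | split 2 b₀ | small₂
      ... | inj₁ v | _ | _ =
        linear 0 (outer′ ⊕ v ⊕ below-s₁ 3 (below-a₀ 3 α) ⊕ size₃) (solve (n ∷ N ∷ b₀ ∷ s₀ ∷ s₁ ∷ s₂ ∷ []))
      ... | _ | inj₂ v | _ =
        linear 0 (layer₀ .bound₃ (below-a₀ 3 α) v ⊕ below-s₁+s₂ 3 (below-a₀ 3 α))
          (solve (n ∷ s₀ ∷ s₁ ∷ s₂ ∷ []))
      ... | inj₂ v | inj₁ _ | inj₁ w =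
        linear 0 (layer₀ .bound₂ (≤-trans (s≤s (s≤s z≤n)) (below-a₀ 3 α)) v
                   ⊕ below-s₁+s₂ 3 (below-a₀ 3 α) ⊕ w ⊕ w)
          (solve (n ∷ s₀ ∷ s₁ ∷ s₂ ∷ []))
      ... | inj₂ _ | inj₁ v | inj₂ w =
        linear (2 * n + 5) (outer′ ⊕ v ⊕ below-s₁ 3 (below-a₀ 3 α) ⊕ w) (solve (n ∷ N ∷ b₀ ∷ s₀ ∷ s₁ ∷ s₂ ∷ []))
      goal .bound₄ α β with split 1 b₀ | split 3 b₀ | small₂
      ... | inj₁ v | _ | _ =
        linear 0 (outer′ ⊕ v ⊕ below-s₁ 4 (below-a₀ 4 α) ⊕ size₄) (solve (n ∷ N ∷ b₀ ∷ s₀ ∷ s₁ ∷ s₂ ∷ []))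
      ... | _ | inj₂ v | _ =
        linear 0 (layer₀ .bound₄ (below-a₀ 4 α) v ⊕ below-s₁+s₂ 4 (below-a₀ 4 α))
          (solve (n ∷ s₀ ∷ s₁ ∷ s₂ ∷ []))
      ... | inj₂ v | inj₁ _ | inj₁ w =
        linear 1 (layer₀ .bound₂ (≤-trans (s≤s (s≤s z≤n)) (below-a₀ 4 α)) v ⊕ below-s₁+s₂ 4 (below-a₀ 4 α)
                   ⊕ w ⊕ w ⊕ w ⊕ w)
          (solve (n ∷ s₀ ∷ s₁ ∷ s₂ ∷ []))
      ... | inj₂ _ | inj₁ v | inj₂ w =
        linear 8 (outer′ ⊕ v ⊕ below-s₁ 4 (below-a₀ 4 α) ⊕ w) (solve (n ∷ N ∷ b₀ ∷ s₀ ∷ s₁ ∷ s₂ ∷ []))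

    module TwoLayers (z : 1 ≤ a₁) where
      1≤a₀ : 1 ≤ a₀
      1≤a₀ = ≤-trans z a₁≤a₀
      h₀ : 2 * n ≤ s₀
      h₀ = layer₀ .bound₁ 1≤a₀ q
      h₁ : 2 * n ≤ s₁
      h₁ = layer₁ .bound₁ z 1≤b₁

      below-a₀ : ∀ m k → m + k ≤ a₀ + a₁ + a₂ → a₁ ≤ k → m ≤ a₀
      below-a₀ m k α y = linear 0 (α ⊕ y ⊕ p) (solve (m ∷ k ∷ a₀ ∷ a₁ ∷ a₂ ∷ []))

      2≤a₀ : 3 ≤ a₀ + a₁ + a₂ → 2 ≤ a₀
      2≤a₀ α with split 1 a₁
      ... | inj₁ y = below-a₀ 2 1 α y
      ... | inj₂ y = ≤-trans y a₁≤a₀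

      goal : Goal
      goal .bound₁ α β = linear n (h₀ ⊕ h₁ ⊕ 1≤a₀ ⊕ a₀≤s₂′ ⊕ 1≤n) (solve (n ∷ a₀ ∷ s₀ ∷ s₁ ∷ s₂ ∷ []))
      goal .bound₂ α β = linear 0 (h₀ ⊕ h₁ ⊕ 1≤a₀ ⊕ a₀≤s₂′) (solve (n ∷ a₀ ∷ s₀ ∷ s₁ ∷ s₂ ∷ []))
      goal .bound₃ α β with split 1 b₀ | small₁
      ... | inj₂ v | _ =
        linear 0 (layer₀ .bound₂ (2≤a₀ α) v ⊕ h₁ ⊕ 2≤a₀ α ⊕ a₀≤s₂′) (solve (n ∷ a₀ ∷ s₀ ∷ s₁ ∷ s₂ ∷ []))
      ... | inj₁ v | inj₁ w =
        linear 1 (h₀ ⊕ h₁ ⊕ 2≤a₀ α ⊕ a₀≤s₂′ ⊕ w ⊕ w) (solve (n ∷ a₀ ∷ s₀ ∷ s₁ ∷ s₂ ∷ []))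
      ... | inj₁ v | inj₂ w =
        linear 0 (outer′ ⊕ v ⊕ h₁ ⊕ w) (solve (n ∷ N ∷ b₀ ∷ s₀ ∷ s₁ ∷ s₂ ∷ []))
      -- The target 8n - 4 is met exactly by both shapes of A: `a₁ ≥ 2` gives (4n - 3) + (4n - 3) +
      -- 2, and `a₁ = 1` gives (6n - 7) + 2n + 3. The remaining cases have a small `b₀` and fall to
      -- `outer′` or to `n ≤ 2`.
      goal .bound₄ α β with split 1 b₀ | split 2 b₀ | split 1 a₁ | small₂
      ... | inj₁ v | _ | _ | _ =
        linear 0 (outer′ ⊕ v ⊕ h₁ ⊕ size₃) (solve (n ∷ N ∷ b₀ ∷ s₀ ∷ s₁ ∷ s₂ ∷ []))
      ... | inj₂ v | _ | inj₂ y | _ =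
        linear 0 (layer₀ .bound₂ (≤-trans y a₁≤a₀) v ⊕ layer₁ .bound₂ y (≤-trans v b₀≤b₁)
                   ⊕ y ⊕ a₁≤a₀ ⊕ a₀≤s₂′)
          (solve (n ∷ a₀ ∷ a₁ ∷ s₀ ∷ s₁ ∷ s₂ ∷ []))
      ... | inj₂ _ | inj₂ v | inj₁ y | _ =
        linear 0 (layer₀ .bound₃ (below-a₀ 3 1 α y) v ⊕ h₁ ⊕ below-a₀ 3 1 α y ⊕ a₀≤s₂′)
          (solve (n ∷ a₀ ∷ s₀ ∷ s₁ ∷ s₂ ∷ []))
      ... | inj₂ v | inj₁ _ | inj₁ y | inj₁ w =
        linear 0 (layer₀ .bound₂ (≤-trans (s≤s (s≤s z≤n)) (below-a₀ 3 1 α y)) v ⊕ h₁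
                   ⊕ below-a₀ 3 1 α y ⊕ a₀≤s₂′ ⊕ w ⊕ w)
          (solve (n ∷ a₀ ∷ s₀ ∷ s₁ ∷ s₂ ∷ []))
      ... | inj₂ _ | inj₁ v | inj₁ y | inj₂ w =
        linear (2 * n + 5) (outer′ ⊕ v ⊕ h₁ ⊕ w) (solve (n ∷ N ∷ b₀ ∷ s₀ ∷ s₁ ∷ s₂ ∷ []))

    goal : Goal
    goal with split 0 a₁
    ... | inj₁ z = OneLayer.goal z
    ... | inj₂ z = TwoLayers.goal z

layers-bounds : ∀ {n N a₀ a₁ a₂ b₀ b₁ b₂ s₀ s₁ s₂} → Size n N →
                Layers n N a₀ a₁ a₂ b₀ b₁ b₂ s₀ s₁ s₂ →
                Bounds (suc n) (a₀ + a₁ + a₂) (b₀ + b₁ + b₂) (s₀ + s₁ + s₂)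
layers-bounds {n} {N} {a₀} {a₁} {a₂} {b₀} {b₁} {b₂} {s₀} {s₁} {s₂} size L
  with split 0 a₂ | split 0 b₀
... | inj₁ p | inj₁ q = Step.BothEmpty.goal size L p q
... | inj₂ p | inj₂ q = Step.BothNonempty.goal size L p q
... | inj₁ p | inj₂ q = Step.OneEmpty.goal size L p q
... | inj₂ p | inj₁ q
  rewrite sum-reverse a₀ a₁ a₂ | sum-reverse b₀ b₁ b₂ | sum-reverse s₀ s₁ s₂ =
  Bounds-sym (Step.OneEmpty.goal size (flip L) q p)

interchange₃ : ∀ x₀ x₁ x₂ y₀ y₁ y₂ →
               x₀ + y₀ + (x₁ + y₁) + (x₂ + y₂) ≡ x₀ + x₁ + x₂ + (y₀ + y₁ + y₂)
interchange₃ = solve-∀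

swap₃ : ∀ x y z → x + y + z ≡ y + x + z
swap₃ = solve-∀

room : ∀ a b s x {N} → a + b + s ≡ N → x + b ≤ N → x ≤ s + a
room a b s x refl h = linear 0 h (solve (a ∷ b ∷ s ∷ x ∷ []))

-- The hypothesis `a₀ + b₂ ≤ N` stands for the disjointness of A₀ and B₂. It leaves room for A₀
-- beside B₂ in layer 2 and beside the smaller B₁ in layer 1, and likewise for B₂.
make-layers : ∀ {n N a₀ a₁ a₂ b₀ b₁ b₂ s₀ s₁ s₂} →
  a₀ + b₀ + s₀ ≡ N → a₁ + b₁ + s₁ ≡ N → a₂ + b₂ + s₂ ≡ N →
  a₀ + b₂ ≤ N → a₁ ≤ a₀ → a₂ ≤ a₁ → b₀ ≤ b₁ → b₁ ≤ b₂ →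
  Bounds n a₀ b₀ s₀ → Bounds n a₁ b₁ s₁ → Bounds n a₂ b₂ s₂ →
  Layers n N a₀ a₁ a₂ b₀ b₁ b₂ s₀ s₁ s₂
make-layers {N = N} {a₀} {a₁} {a₂} {b₀} {b₁} {b₂} {s₀} {s₁} {s₂}
            e₀ e₁ e₂ d a₁≤a₀ a₂≤a₁ b₀≤b₁ b₁≤b₂ L₀ L₁ L₂ = record
  { a₁≤a₀ = a₁≤a₀ ; a₂≤a₁ = a₂≤a₁ ; b₀≤b₁ = b₀≤b₁ ; b₁≤b₂ = b₁≤b₂
  ; layer₀ = L₀ ; layer₁ = L₁ ; layer₂ = L₂
  ; outer = subst (_≤ s₀ + s₂ + (a₂ + b₀)) e₂ (collect a₂ b₀ b₂ s₀ s₂ b₂≤s₀+b₀)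
  ; a₀≤s₂ = room a₂ b₂ s₂ a₀ e₂ d
  ; b₂≤s₀ = b₂≤s₀+b₀
  ; a₀≤s₁ = room a₁ b₁ s₁ a₀ e₁ (≤-trans (+-monoʳ-≤ a₀ b₁≤b₂) d)
  ; b₂≤s₁ = room b₁ a₁ s₁ b₂ (trans (swap₃ b₁ a₁ s₁) e₁) (≤-trans (+-monoʳ-≤ b₂ a₁≤a₀) d′)
  }
  where
  d′ : b₂ + a₀ ≤ N
  d′ = subst (_≤ N) (+-comm a₀ b₂) d
  b₂≤s₀+b₀ : b₂ ≤ s₀ + b₀
  b₂≤s₀+b₀ = room b₀ a₀ s₀ b₂ (trans (swap₃ b₀ a₀ s₀) e₀) d′
  collect : ∀ a₂ b₀ b₂ s₀ s₂ → b₂ ≤ s₀ + b₀ → a₂ + b₂ + s₂ ≤ s₀ + s₂ + (a₂ + b₀)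
  collect a₂ b₀ b₂ s₀ s₂ h = linear 0 h (solve (a₂ ∷ b₀ ∷ b₂ ∷ s₀ ∷ s₂ ∷ []))

-- Compression keeps the sizes of A and B, so the uncovered part of the three layers does not exceed
-- the original one.
sum-of-slices : ∀ a₀ a₁ a₂ b₀ b₁ b₂ s₀ s₁ s₂ {N s} →
                a₀ + b₀ + s₀ ≡ N → a₁ + b₁ + s₁ ≡ N → a₂ + b₂ + s₂ ≡ N →
                3 * N ≤ (a₀ + a₁ + a₂) + (b₀ + b₁ + b₂) + s → s₀ + s₁ + s₂ ≤ s
sum-of-slices a₀ a₁ a₂ b₀ b₁ b₂ s₀ s₁ s₂ {N} {s} e₀ e₁ e₂ h =
  +-cancelˡ-≤ (a₀ + a₁ + a₂ + (b₀ + b₁ + b₂)) _ _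
    (subst (_≤ a₀ + a₁ + a₂ + (b₀ + b₁ + b₂) + s) eq h)
  where
  open ≡-Reasoning
  eq : 3 * N ≡ a₀ + a₁ + a₂ + (b₀ + b₁ + b₂) + (s₀ + s₁ + s₂)
  eq = begin
    3 * N  ≡⟨ cong (λ x → N + (N + x)) (+-identityʳ N) ⟩
    N + (N + N) ≡⟨ +-assoc N N N ⟨
    N + N + N   ≡⟨ cong₂ _+_ (cong₂ _+_ e₀ e₁) e₂ ⟨
    _           ≡⟨ interchange₃ (a₀ + b₀) (a₁ + b₁) (a₂ + b₂) s₀ s₁ s₂ ⟩
    _           ≡⟨ cong (_+ (s₀ + s₁ + s₂)) (interchange₃ a₀ a₁ a₂ b₀ b₁ b₂) ⟩
    _ ∎

-- Opened only here: overloaded _∷_ would make the variable lists above ambiguous.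
open import Data.List using (List; length; map; filter; cartesianProductWith; allFin)
import Data.List.Membership.DecPropositional as DecMembership
open import Data.List.Membership.Propositional using (_∈_; _∉_)
open import Data.List.Membership.Propositional.Properties
  using (∈-filter⁺; ∈-filter⁻; ∈-cartesianProductWith⁺; ∈-allFin)
open import Data.List.Properties using (length-map)
open import Data.List.Relation.Unary.All as All using (All; []; _∷_)
import Data.List.Relation.Unary.All.Properties as All
open import Data.List.Relation.Unary.AllPairs using ([]; _∷_)
open import Data.List.Relation.Unary.Any using (here)
open import Data.List.Relation.Unary.Unique.DecPropositional using (unique?)
open import Data.List.Relation.Unary.Unique.Propositional using (Unique)
import Data.List.Relation.Unary.Unique.Propositional.Properties as Unique
import Data.Product.Properties as Product
import Data.Sum as Sum
open import Data.Vec using ([]; _∷_; lookup; replicate)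
import Data.Vec.Properties as Vec

-- Sums and counts over the vertices of the cube.

pattern 0F = zero
pattern 1F = suc zero
pattern 2F = suc (suc zero)

∑ : ∀ {n} → (Vertex n → ℕ) → ℕ
∑ {zero}  f = f []
∑ {suc n} f = ∑ (λ v → f (0F ∷ v)) + ∑ (λ v → f (1F ∷ v)) + ∑ (λ v → f (2F ∷ v))

∑-mono : ∀ {n} {f g : Vertex n → ℕ} → (∀ v → f v ≤ g v) → ∑ f ≤ ∑ g
∑-mono {zero}  f≤g = f≤g []
∑-mono {suc n} f≤g =
  ∑-mono (λ v → f≤g (0F ∷ v)) ⊕ ∑-mono (λ v → f≤g (1F ∷ v)) ⊕ ∑-mono (λ v → f≤g (2F ∷ v))

∑-cong : ∀ {n} {f g : Vertex n → ℕ} → (∀ v → f v ≡ g v) → ∑ f ≡ ∑ g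
∑-cong f≡g = ≤-antisym (∑-mono λ v → ≤-reflexive (f≡g v))
                       (∑-mono λ v → ≤-reflexive (sym (f≡g v)))

∑-+ : ∀ {n} (f g : Vertex n → ℕ) → ∑ (λ v → f v + g v) ≡ ∑ f + ∑ g
∑-+ {zero}  f g = refl
∑-+ {suc n} f g =
  trans (cong₂ _+_ (cong₂ _+_ (∑-+ (λ v → f (0F ∷ v)) (λ v → g (0F ∷ v)))
                              (∑-+ (λ v → f (1F ∷ v)) (λ v → g (1F ∷ v))))
                   (∑-+ (λ v → f (2F ∷ v)) (λ v → g (2F ∷ v))))
        (interchange₃ (∑ λ v → f (0F ∷ v)) (∑ λ v → f (1F ∷ v)) (∑ λ v → f (2F ∷ v)) _ _ _)

∑-+₃ : ∀ {n} (f g h : Vertex n → ℕ) → ∑ (λ v → f v + g v + h v) ≡ ∑ f + ∑ g + ∑ h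
∑-+₃ f g h = trans (∑-+ (λ v → f v + g v) h) (cong (_+ ∑ h) (∑-+ f g))

∑-const : ∀ n k → ∑ {n} (λ _ → k) ≡ 3 ^ n * k
∑-const zero    k = sym (+-identityʳ k)
∑-const (suc n) k rewrite ∑-const n k = triple (3 ^ n) k
  where
  triple : ∀ N k → N * k + N * k + N * k ≡ 3 * N * k
  triple = solve-∀

bit : Bool → ℕ
bit false = 0
bit true  = 1

bit≤1 : ∀ b → bit b ≤ 1
bit≤1 false = z≤n
bit≤1 true  = ≤-refl

count : ∀ {n} → (Vertex n → Bool) → ℕ
count p = ∑ (λ v → bit (p v))

-- Separated sets and compression along the first coordinate.

Near : ∀ {n} → Vertex n → Vertex n → Set
Near {n} u v = u ≡ v ⊎ Adj n u v

-- This is special to the alphabet of size 3: every line in a coordinate direction is a triangle.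
≢⇒±1 : ∀ {x y : Fin 3} → x ≢ y → x ±1≡ y
≢⇒±1 {0F} {0F} x≢y = contradiction refl x≢y
≢⇒±1 {0F} {1F} x≢y = inj₂ refl
≢⇒±1 {0F} {2F} x≢y = inj₁ refl
≢⇒±1 {1F} {0F} x≢y = inj₁ refl
≢⇒±1 {1F} {1F} x≢y = contradiction refl x≢y
≢⇒±1 {1F} {2F} x≢y = inj₂ refl
≢⇒±1 {2F} {0F} x≢y = inj₂ refl
≢⇒±1 {2F} {1F} x≢y = inj₁ refl
≢⇒±1 {2F} {2F} x≢y = contradiction refl x≢y

Adj-head : ∀ {n x y} {v : Vertex n} → x ≢ y → Adj (suc n) (x ∷ v) (y ∷ v)
Adj-head x≢y = zero , ≢⇒±1 x≢y , λ { zero 0≢0 → contradiction refl 0≢0 ; (suc i) _ → refl }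

Adj-tail : ∀ {n x} {u v : Vertex n} → Adj n u v → Adj (suc n) (x ∷ u) (x ∷ v)
Adj-tail (j , uⱼ±1vⱼ , same) =
  suc j , uⱼ±1vⱼ , λ { zero _ → refl ; (suc i) i≢j → same i λ i≡j → i≢j (cong suc i≡j) }

Near-head : ∀ {n} x y (v : Vertex n) → Near (x ∷ v) (y ∷ v)
Near-head x y v with x Fin.≟ y
... | yes refl = inj₁ refl
... | no x≢y   = inj₂ (Adj-head x≢y)

Near-tail : ∀ {n} x {u v : Vertex n} → Near u v → Near (x ∷ u) (x ∷ v)
Near-tail x (inj₁ u≡v) = inj₁ (cong (x ∷_) u≡v)
Near-tail x (inj₂ u~v) = inj₂ (Adj-tail u~v)

-- The case `u ≡ v` expresses disjointness, the case `Adj` the absence of edges. The numerical form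
-- allows these conditions to be added up along a line.
Separated : ∀ {n} → (A B : Vertex n → Bool) → Set
Separated A B = ∀ {u v} → Near u v → bit (A u) + bit (B v) ≤ 1

height : ∀ {n} → (Vertex (suc n) → Bool) → Vertex n → ℕ
height A v = bit (A (0F ∷ v)) + bit (A (1F ∷ v)) + bit (A (2F ∷ v))

-- Layer k of the compression of A along the first coordinate, which moves
-- the members of A on every line into the layers 0, 1, …
level : ∀ {n} → ℕ → (Vertex (suc n) → Bool) → Vertex n → Bool
level k A v = k <ᵇ height A v

level-sum : ∀ {n} (A : Vertex (suc n) → Bool) →
            count (level 0 A) + count (level 1 A) + count (level 2 A) ≡ count A
level-sum A = begin
  count (level 0 A) + count (level 1 A) + count (level 2 A)
    ≡⟨ ∑-+₃ (λ v → bit (level 0 A v)) (λ v → bit (level 1 A v)) (λ v → bit (level 2 A v)) ⟨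
  ∑ (λ v → bit (level 0 A v) + bit (level 1 A v) + bit (level 2 A v))
    ≡⟨ ∑-cong (λ v → stack (A (0F ∷ v)) (A (1F ∷ v)) (A (2F ∷ v))) ⟩
  ∑ (height A)
    ≡⟨ ∑-+₃ (λ v → bit (A (0F ∷ v))) (λ v → bit (A (1F ∷ v))) (λ v → bit (A (2F ∷ v))) ⟩
  count A ∎
  where
  open ≡-Reasoning
  stack : ∀ x y z → let h = bit x + bit y + bit z in
          bit (0 <ᵇ h) + bit (1 <ᵇ h) + bit (2 <ᵇ h) ≡ h
  stack false false false = refl
  stack false false true  = refl
  stack false true  false = refl
  stack false true  true  = refl
  stack true  false false = refl
  stack true  false true  = refl
  stack true  true  false = refl
  stack true  true  true  = refl

bit-<ᵇ-mono : ∀ {j k} h → j ≤ k → bit (k <ᵇ h) ≤ bit (j <ᵇ h)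
bit-<ᵇ-mono {zero}  {k}     zero    j≤k       = ≤-refl
bit-<ᵇ-mono {zero}  {k}     (suc h) j≤k with k <ᵇ suc h
... | true  = ≤-refl
... | false = z≤n
bit-<ᵇ-mono {suc j} {suc k} zero    j≤k       = z≤n
bit-<ᵇ-mono {suc j} {suc k} (suc h) (s≤s j≤k) = bit-<ᵇ-mono h j≤k

count-level-mono : ∀ {n j k} (A : Vertex (suc n) → Bool) → j ≤ k →
                   count (level k A) ≤ count (level j A)
count-level-mono A j≤k = ∑-mono λ v → bit-<ᵇ-mono (height A v) j≤k

bits-exclusive : ∀ k l g h → g + h ≤ suc (k + l) → bit (k <ᵇ g) + bit (l <ᵇ h) ≤ 1
bits-exclusive k l g h p with k <ᵇ g in k<g | l <ᵇ h in l<h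
... | false | false = z≤n
... | false | true  = ≤-refl
... | true  | false = ≤-refl
... | true  | true  = contradiction (≤-trans (≤-reflexive (sym (+-suc (suc k) l)))
                        (≤-trans (<ᵇ⇒< k g (subst T (sym k<g) _) ⊕ <ᵇ⇒< l h (subst T (sym l<h) _)) p)) 1+n≰n

-- The lines above `u` and `v` are near in each of the three layers, so the heights add up to at
-- most 3, whereas membership in both levels would force at least `k + l + 2`, hence 4.
level-separated : ∀ {n} (A B : Vertex (suc n) → Bool) → Separated A B →
                  ∀ k l → 2 ≤ k + l → Separated (level k A) (level l B)
level-separated A B sep k l 2≤k+l {u} {v} u~v = bits-exclusive k l (height A u) (height B v) (begin
  height A u + height B v
    ≡⟨ interchange₃ (bit (A (0F ∷ u))) (bit (A (1F ∷ u))) (bit (A (2F ∷ u))) _ _ _ ⟨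
  _ ≤⟨ sep (Near-tail 0F u~v) ⊕ sep (Near-tail 1F u~v) ⊕ sep (Near-tail 2F u~v) ⟩
  3 ≤⟨ s≤s 2≤k+l ⟩
  suc (k + l) ∎)
  where open ≤-Reasoning

-- A line is a triangle, so one that meets A contains no vertex of B. This gives the disjointness of
-- A₀ and B₂, as level 0 of B is placed in layer 2.
level₀-disjoint : ∀ {n} (A B : Vertex (suc n) → Bool) → Separated A B →
                  ∀ v → bit (level 0 A v) + bit (level 0 B v) ≤ 1
level₀-disjoint A B sep v =
  lines (λ i → A (i ∷ v)) (λ i → B (i ∷ v)) (λ i j → sep (Near-head i j v))
  where
  total : (Fin 3 → Bool) → ℕ
  total f = bit (f 0F) + bit (f 1F) + bit (f 2F)

  member : ∀ f → 0 < total f → ∃[ i ] f i ≡ true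
  member f 0<f with f 0F in f₀ | f 1F in f₁ | f 2F in f₂
  ... | true  | _     | _    = 0F , f₀
  ... | false | true  | _    = 1F , f₁
  ... | false | false | true = 2F , f₂

  bit-zero : ∀ {g} → g ≤ 0 → bit (0 <ᵇ g) ≤ 0
  bit-zero z≤n = z≤n

  lines : ∀ f g → (∀ i j → bit (f i) + bit (g j) ≤ 1) →
          bit (0 <ᵇ total f) + bit (0 <ᵇ total g) ≤ 1
  lines f g p with split 0 (total f)
  ... | inj₁ f≤0 = +-mono-≤ (bit-zero f≤0) (bit≤1 (0 <ᵇ total g))
  ... | inj₂ 0<f = +-mono-≤ (bit≤1 (0 <ᵇ total f)) (bit-zero (g-empty 0F ⊕ g-empty 1F ⊕ g-empty 2F))
    where
    g-empty : ∀ j → bit (g j) ≤ 0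
    g-empty j = let i , fi = member f 0<f in
      s≤s⁻¹ (subst (λ b → bit b + bit (g j) ≤ 1) fi (p i j))

disjoint-count : ∀ {n} (A B : Vertex n → Bool) → (∀ v → bit (A v) + bit (B v) ≤ 1) →
                 count A + count B ≤ 3 ^ n
disjoint-count {n} A B disjoint = begin
  count A + count B                   ≡⟨ ∑-+ (λ v → bit (A v)) (λ v → bit (B v)) ⟨
  ∑ (λ v → bit (A v) + bit (B v))     ≤⟨ ∑-mono disjoint ⟩
  ∑ {n} (λ _ → 1)                     ≡⟨ ∑-const n 1 ⟩
  3 ^ n * 1                           ≡⟨ *-identityʳ (3 ^ n) ⟩
  3 ^ n                               ∎
  where open ≤-Reasoning

-- A is compressed downwards and B upwards: a line above u and one above v hold
-- at most 3 members of A and B together, so the compressed layers stay separated.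
separated-bounds : ∀ n (A B : Vertex (suc n) → Bool) → Separated A B →
                   ∀ s → 3 ^ suc n ≤ count A + count B + s → Bounds (suc n) (count A) (count B) s
-- The cube of dimension 1 is a triangle, so two nonempty sets are never separated and all bounds
-- hold vacuously.
separated-bounds zero A B sep s N≤ = record
  { bound₁ = λ p q → empty p q ; bound₂ = λ p q → empty (≤-trans (s≤s z≤n) p) (≤-trans (s≤s z≤n) q)
  ; bound₃ = λ p q → empty (≤-trans (s≤s z≤n) p) (≤-trans (s≤s z≤n) q)
  ; bound₄ = λ p q → empty (≤-trans (s≤s z≤n) p) (≤-trans (s≤s z≤n) q) }
  where
  empty : ∀ {ℓ} {X : Set ℓ} → 1 ≤ count A → 1 ≤ count B → X
  empty p q = contradiction (≤-trans (occupied p ⊕ occupied q) (level₀-disjoint A B sep [])) 1+n≰n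
    where
    occupied : ∀ {h} → 1 ≤ h → 1 ≤ bit (0 <ᵇ h)
    occupied (s≤s _) = ≤-refl
separated-bounds (suc n) A B sep s N≤ = subst₂ (λ a b → Bounds (suc (suc n)) a b s) (level-sum A) ΣB
  -- Layer i holds level i of A and level 2 - i of B, whence the reversed order of the `b k`.
  (Bounds-mono (sum-of-slices (a 0) (a 1) (a 2) (b 2) (b 1) (b 0)
                  (s′ 0 2 ≤-refl) (s′ 1 1 ≤-refl) (s′ 2 0 ≤-refl)
                  (eq 0 2 ≤-refl) (eq 1 1 ≤-refl) (eq 2 0 ≤-refl)
                  (subst₂ (λ a b → 3 ^ suc (suc n) ≤ a + b + s) (sym (level-sum A)) (sym ΣB) N≤))
    (layers-bounds (3^-size n)
      (make-layers (eq 0 2 ≤-refl) (eq 1 1 ≤-refl) (eq 2 0 ≤-refl)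
        (disjoint-count (level 0 A) (level 0 B) (level₀-disjoint A B sep))
        (count-level-mono A z≤n) (count-level-mono A (s≤s z≤n))
        (count-level-mono B (s≤s z≤n)) (count-level-mono B z≤n)
        (bounds 0 2 ≤-refl) (bounds 1 1 ≤-refl) (bounds 2 0 ≤-refl))))
  where
  a b : ℕ → ℕ
  a k = count (level k A)
  b k = count (level k B)

  ΣB : b 2 + b 1 + b 0 ≡ count B
  ΣB = trans (sum-reverse (b 2) (b 1) (b 0)) (level-sum B)

  module _ (k l : ℕ) (2≤k+l : 2 ≤ k + l) where
    sep′ : Separated (level k A) (level l B)
    sep′ = level-separated A B sep k l 2≤k+l

    rest : ∃[ s ] a k + b l + s ≡ 3 ^ suc n
    rest = m≤n⇒∃[o]m+o≡n (disjoint-count (level k A) (level l B) λ v → sep′ (inj₁ refl))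

    s′ : ℕ
    s′ = proj₁ rest
    eq : a k + b l + s′ ≡ 3 ^ suc n
    eq = proj₂ rest

    bounds : Bounds (suc n) (a k) (b l) s′
    bounds = separated-bounds n (level k A) (level l B) sep′ s′ (≤-reflexive (sym eq))

-- Counting the members of a list.

_≟ᵥ_ : ∀ {n} → DecidableEquality (Vertex n)
_≟ᵥ_ = Vec.≡-dec Fin._≟_

module _ {n : ℕ} where
  open DecMembership (_≟ᵥ_ {n}) using (_∈?_) public

∑-zero : ∀ n → ∑ {n} (λ _ → 0) ≡ 0
∑-zero n = trans (∑-const n 0) (*-zeroʳ (3 ^ n))

bit-does-mono : ∀ {P Q : Set} (P? : Dec P) (Q? : Dec Q) → (P → Q) → bit (does P?) ≤ bit (does Q?)
bit-does-mono (no _)  _       P→Q = z≤n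
bit-does-mono (yes p) (yes _) P→Q = ≤-refl
bit-does-mono (yes p) (no ¬q) P→Q = contradiction (P→Q p) ¬q

bit-does-exclusive : ∀ {P Q : Set} (P? : Dec P) (Q? : Dec Q) → (P → ¬ Q) →
                     bit (does P?) + bit (does Q?) ≤ 1
bit-does-exclusive (no _)  (no _)  P→¬Q = z≤n
bit-does-exclusive (no _)  (yes _) P→¬Q = ≤-refl
bit-does-exclusive (yes _) (no _)  P→¬Q = ≤-refl
bit-does-exclusive (yes p) (yes q) P→¬Q = contradiction q (P→¬Q p)

count-≟ : ∀ {n} (u : Vertex n) → count (λ v → does (v ≟ᵥ u)) ≡ 1
count-≟ []       = refl
count-≟ {suc n} (0F ∷ u) rewrite count-≟ u | ∑-zero n = refl
count-≟ {suc n} (1F ∷ u) rewrite count-≟ u | ∑-zero n = refl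
count-≟ {suc n} (2F ∷ u) rewrite count-≟ u | ∑-zero n = refl

count-∈ : ∀ {n} {xs : List (Vertex n)} → Unique xs → count (λ v → does (v ∈? xs)) ≡ length xs
count-∈ {n} {[]}     _            = ∑-zero n
count-∈ {n} {x ∷ xs} (x∉xs ∷ uxs) = begin
  count (λ v → does (v ∈? (x ∷ xs)))
    ≡⟨ ∑-cong (λ v → disjoint-∨ (v ≟ᵥ x) (v ∈? xs) λ { refl → All.All¬⇒¬Any x∉xs }) ⟩
  ∑ (λ v → bit (does (v ≟ᵥ x)) + bit (does (v ∈? xs)))
    ≡⟨ ∑-+ (λ v → bit (does (v ≟ᵥ x))) (λ v → bit (does (v ∈? xs))) ⟩
  count (λ v → does (v ≟ᵥ x)) + count (λ v → does (v ∈? xs))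
    ≡⟨ cong₂ _+_ (count-≟ x) (count-∈ uxs) ⟩
  suc (length xs) ∎
  where
  open ≡-Reasoning
  disjoint-∨ : ∀ {P Q : Set} (P? : Dec P) (Q? : Dec Q) → (P → ¬ Q) →
               bit (does P? ∨ does Q?) ≡ bit (does P?) + bit (does Q?)
  disjoint-∨ (no _)  _       P→¬Q = refl
  disjoint-∨ (yes _) (no _)  P→¬Q = refl
  disjoint-∨ (yes p) (yes q) P→¬Q = contradiction q (P→¬Q p)

length≤count : ∀ {n} {P : Vertex n → Set} (P? : Decidable P) {xs} → Unique xs → All P xs →
               length xs ≤ count (λ v → does (P? v))
length≤count P? {xs} uxs Pxs = subst (_≤ _) (count-∈ uxs)
  (∑-mono λ v → bit-does-mono (v ∈? xs) (P? v) (All.lookup Pxs))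

-- Walks and the lower bound for extra cuts.

Adj-sym : ∀ {n} (u v : Vertex n) → Adj n u v → Adj n v u
Adj-sym u v (j , uⱼ±1vⱼ , same) = j , Sum.swap uⱼ±1vⱼ , λ i i≢j → sym (same i i≢j)

module _ {n : ℕ} {S : VertexSet n} where

  Walk-end : ∀ {u v} → Walk n S u v → v ∉ elems S
  Walk-end (here u∉S)   = u∉S
  Walk-end (step _ _ w) = Walk-end w

  Walk-trans : ∀ {u v w} → Walk n S u v → Walk n S v w → Walk n S u w
  Walk-trans (here _)           q = q
  Walk-trans (step u∉S u~u′ p) q = step u∉S u~u′ (Walk-trans p q)

  Walk-near : ∀ {u v} → u ∉ elems S → v ∉ elems S → Near u v → Walk n S u v
  Walk-near u∉S v∉S (inj₁ refl) = here u∉S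
  Walk-near u∉S v∉S (inj₂ u~v)  = step u∉S u~v (here v∉S)

  Walk-sym : ∀ {u v} → Walk n S u v → Walk n S v u
  Walk-sym (here u∉S)         = here u∉S
  Walk-sym (step {u} {u′} u∉S u~u′ p) =
    Walk-trans (Walk-sym p) (step (Walk-end (Walk-sym p)) (Adj-sym u u′ u~u′) (here u∉S))

-- Connectedness is decidable only up to ¬ ¬ without a search procedure; that
-- is enough for a goal of the form k ≤ ∣ S ∣ᵥ.
¬¬-∀ : ∀ {n} {P : Vertex n → Set} → (∀ v → ¬ ¬ P v) → ¬ ¬ (∀ v → P v)
¬¬-∀ {zero}  ¬¬P k = ¬¬P [] λ p → k λ { [] → p }
¬¬-∀ {suc n} ¬¬P k =
  ¬¬-∀ (λ v → ¬¬P (0F ∷ v)) λ p₀ →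
  ¬¬-∀ (λ v → ¬¬P (1F ∷ v)) λ p₁ →
  ¬¬-∀ (λ v → ¬¬P (2F ∷ v)) λ p₂ →
  k λ { (0F ∷ v) → p₀ v ; (1F ∷ v) → p₁ v ; (2F ∷ v) → p₂ v }

cut-lower-bound : ∀ n (S : VertexSet (suc n)) → IsExtraCut (suc n) 3 S → 8 * suc n ≤ ∣ S ∣ᵥ + 12
cut-lower-bound n S ((u , v , u∉S , v∉S , u≁v) , large) =
  decidable-stable (_ ≤? _) λ ¬goal → ¬¬-∀ (λ w → ¬¬-excluded-middle) λ conn → ¬goal (bound conn)
  where
  bound : (∀ w → Dec (Connected (suc n) S u w)) → 8 * suc n ≤ ∣ S ∣ᵥ + 12
  bound A? = Bounds.bound₄
    (separated-bounds n A B separated ∣ S ∣ᵥ covered)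
    (enough A? (large u u∉S) λ p → p)
    -- The whole component of `v` lies in `B`: a vertex of it reachable from `u` would connect `u`
    -- with `v`.
    (enough B? (large v v∉S) λ p → Walk-end p , λ q → u≁v (Walk-trans q (Walk-sym p)))
    where
    B? : Decidable (λ w → w ∉ elems S × ¬ Connected (suc n) S u w)
    B? w = ¬? (w ∈? elems S) ×-dec ¬? (A? w)

    A B : Vertex (suc n) → Bool
    A w = does (A? w)
    B w = does (B? w)

    separated : Separated A B
    separated {x} {y} x~y = bit-does-exclusive (A? x) (B? y) λ p (y∉S , ¬q) →
      ¬q (Walk-trans p (Walk-near (Walk-end p) y∉S x~y))

    covered : 3 ^ suc n ≤ count A + count B + ∣ S ∣ᵥ
    covered = begin
      3 ^ suc n          ≡⟨ *-identityʳ (3 ^ suc n) ⟨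
      3 ^ suc n * 1      ≡⟨ ∑-const (suc n) 1 ⟨
      ∑ {suc n} (λ _ → 1) ≤⟨ ∑-mono (λ w → cover (A? w) (w ∈? elems S)) ⟩
      ∑ (λ w → bit (A w) + bit (B w) + bit (does (w ∈? elems S)))
        ≡⟨ ∑-+₃ (λ w → bit (A w)) (λ w → bit (B w)) (λ w → bit (does (w ∈? elems S))) ⟩
      count A + count B + count (λ w → does (w ∈? elems S))
        ≡⟨ cong (count A + count B +_) (count-∈ (unique S)) ⟩
      count A + count B + ∣ S ∣ᵥ ∎
      where
      open ≤-Reasoning
      cover : ∀ {P Q : Set} (P? : Dec P) (Q? : Dec Q) →
              1 ≤ bit (does P?) + bit (does (¬? Q? ×-dec ¬? P?)) + bit (does Q?)
      cover (yes _) (yes _) = s≤s z≤n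
      cover (yes _) (no _)  = s≤s z≤n
      cover (no _)  (yes _) = s≤s z≤n
      cover (no _)  (no _)  = s≤s z≤n

    enough : ∀ {w} {P : Vertex (suc n) → Set} (P? : Decidable P) →
             ∃[ C ] (Unique C × length C ≡ 4 × All (Connected (suc n) S w) C) →
             (∀ {x} → Connected (suc n) S w x → P x) → 4 ≤ count (λ x → does (P? x))
    enough P? (C , uC , |C|≡4 , walks) w→P =
      subst (_≤ _) |C|≡4 (length≤count P? uC (All.map w→P walks))

-- Vertex sets defined by decidable predicates.

vertices : ∀ n → List (Vertex n)
vertices zero    = [] ∷ []
vertices (suc n) = cartesianProductWith _∷_ (allFin 3) (vertices n)

∈-vertices : ∀ {n} (v : Vertex n) → v ∈ vertices n
∈-vertices []      = here refl
∈-vertices (x ∷ v) = ∈-cartesianProductWith⁺ _∷_ (∈-allFin x) (∈-vertices v)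

vertices-unique : ∀ n → Unique (vertices n)
vertices-unique zero    = [] ∷ []
vertices-unique (suc n) =
  Unique.cartesianProductWith⁺ _∷_ Vec.∷-injective (Unique.allFin⁺ 3) (vertices-unique n)

comprehension : ∀ {n} {P : Vertex n → Set} → Decidable P → VertexSet n
comprehension {n} P? = vset (filter P? (vertices n)) (Unique.filter⁺ P? (vertices-unique n))

module _ {n : ℕ} {P : Vertex n → Set} (P? : Decidable P) where

  ∉-comprehension⁺ : ∀ {v} → ¬ P v → v ∉ elems (comprehension P?)
  ∉-comprehension⁺ ¬p v∈ = ¬p (proj₂ (∈-filter⁻ P? {xs = vertices n} v∈))

  ∉-comprehension⁻ : ∀ {v} → v ∉ elems (comprehension P?) → ¬ P v
  ∉-comprehension⁻ v∉ p = v∉ (∈-filter⁺ P? (∈-vertices _) p)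

  ∣comprehension∣ : ∣ comprehension P? ∣ᵥ ≡ count (λ v → does (P? v))
  ∣comprehension∣ = trans (sym (count-∈ (unique (comprehension P?)))) (≤-antisym
    (∑-mono λ v → bit-does-mono (v ∈? _) (P? v) λ v∈ → proj₂ (∈-filter⁻ P? {xs = vertices n} v∈))
    (∑-mono λ v → bit-does-mono (P? v) (v ∈? _) (∈-filter⁺ P? (∈-vertices v))))

-- The neighbourhood of a 4-cycle as a sphere of radius 1, and its size.

Lipschitz : ∀ {n} → (Vertex n → ℕ) → Set
Lipschitz {n} f = ∀ u v → Adj n u v → f v ≤ suc (f u)

lookup-ext : ∀ {n} (u v : Vertex n) → (∀ i → lookup u i ≡ lookup v i) → u ≡ v
lookup-ext []      []      _  = refl
lookup-ext (x ∷ u) (y ∷ v) eq = cong₂ _∷_ (eq zero) (lookup-ext u v (eq ∘ suc))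

-- An edge changes either the first entry, which affects a single bit, or the tail, where the
-- hypothesis on `f` applies.
Lipschitz-∷ : ∀ {n} (p : Fin 3 → Bool) {f : Vertex n → ℕ} → Lipschitz f →
              Lipschitz {suc n} (λ { (x ∷ v) → bit (p x) + f v })
Lipschitz-∷ p {f} lip (x ∷ u) (y ∷ v) (zero , _ , same)
  rewrite lookup-ext u v (λ i → same (suc i) λ ()) =
  ≤-trans (+-monoˡ-≤ (f v) (bit≤1 (p y))) (s≤s (m≤n+m (f v) (bit (p x))))
Lipschitz-∷ p {f} lip (x ∷ u) (y ∷ v) (suc j , ±1 , same) with same zero (λ ())
... | refl = ≤-trans
  (+-monoʳ-≤ (bit (p x)) (lip u v (j , ±1 , λ i i≢j → same (suc i) (i≢j ∘ Fin.suc-injective))))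
  (≤-reflexive (+-suc (bit (p x)) (f u)))

isTwo nonzero : Fin 3 → Bool
isTwo 2F = true
isTwo _  = false
nonzero 0F = false
nonzero _  = true

weight : ∀ {n} → Vertex n → ℕ
weight []      = 0
weight (x ∷ v) = bit (nonzero x) + weight v

weight-Lipschitz : ∀ {n} → Lipschitz (weight {n})
weight-Lipschitz {suc n} (x ∷ u) (y ∷ v) = Lipschitz-∷ nonzero {weight} weight-Lipschitz (x ∷ u) (y ∷ v)

-- The distance to the 4-cycle {0,1}² × {0…0}.
dist : ∀ {n} → Vertex (2 + n) → ℕ
dist (x ∷ y ∷ v) = bit (isTwo x) + (bit (isTwo y) + weight v)

dist-Lipschitz : ∀ {n} → Lipschitz (dist {n})
dist-Lipschitz (x ∷ y ∷ u) (x′ ∷ y′ ∷ v) =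
  Lipschitz-∷ isTwo {λ { (y ∷ v) → bit (isTwo y) + weight v }}
    (λ { (y ∷ u) (y′ ∷ v) → Lipschitz-∷ isTwo {weight} weight-Lipschitz (y ∷ u) (y′ ∷ v) })
    (x ∷ y ∷ u) (x′ ∷ y′ ∷ v)

dist≟1 : ∀ {n} → Decidable (λ (v : Vertex (2 + n)) → dist v ≡ 1)
dist≟1 v = dist v ≟ 1

sphere : ∀ n → VertexSet (2 + n)
sphere n = comprehension dist≟1

count-weight-0 : ∀ n → ∑ {n} (λ v → bit (weight v ≡ᵇ 0)) ≡ 1
count-weight-0 zero    = refl
count-weight-0 (suc n) rewrite count-weight-0 n | ∑-zero n = refl

count-weight-1 : ∀ n → ∑ {n} (λ v → bit (weight v ≡ᵇ 1)) ≡ 2 * n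
count-weight-1 zero    = refl
count-weight-1 (suc n) rewrite count-weight-1 n | count-weight-0 n = double-suc n
  where
  double-suc : ∀ n → 2 * n + 1 + 1 ≡ 2 * suc n
  double-suc = solve-∀

-- The first two entries cut the cube into nine blocks. The four blocks without a 2 contribute the
-- `2 * n` tails of weight 1 each, the four with exactly one 2 contribute the zero tail, and the
-- last contributes nothing. In dimension `2 + n` the total equals 8(n + 2) - 12.
∣sphere∣ : ∀ n → ∣ sphere n ∣ᵥ ≡ 8 * n + 4
∣sphere∣ n = trans (∣comprehension∣ (dist≟1 {n}))
  (nine-blocks (count-weight-1 n) (count-weight-0 n) (∑-zero n))
  where
  total : ∀ n → 2 * n + 2 * n + 1 + (2 * n + 2 * n + 1) + (1 + 1 + 0) ≡ 8 * n + 4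
  total = solve-∀
  nine-blocks : ∀ {p q r} → p ≡ 2 * n → q ≡ 1 → r ≡ 0 →
                p + p + q + (p + p + q) + (q + q + r) ≡ 8 * n + 4
  nine-blocks refl refl refl = total n

-- The components outside the sphere.

module _ {n : ℕ} where

  Good : Vertex (2 + n) → Set
  Good v = dist v ≢ 1

  Path : Vertex (2 + n) → Vertex (2 + n) → Set
  Path = Walk (2 + n) (sphere n)

  path-near : ∀ {u v} → Good u → Good v → Near u v → Path u v
  path-near u-good v-good =
    Walk-near (∉-comprehension⁺ (dist≟1 {n}) u-good) (∉-comprehension⁺ (dist≟1 {n}) v-good)

  -- One step changes `dist` from 0 to at most 1, and the vertices at distance 1 are removed.
  inside : ∀ {u v} → dist u ≡ 0 → Path u v → dist v ≡ 0
  inside d≡0 (here _) = d≡0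
  inside {u} d≡0 (step {w = w} _ u~w p) = inside (zero-next _ (dist-Lipschitz u w u~w) (start p)) p
    where
    start : ∀ {v} → Path w v → Good w
    start (here w∉)     = ∉-comprehension⁻ (dist≟1 {n}) w∉
    start (step w∉ _ _) = ∉-comprehension⁻ (dist≟1 {n}) w∉
    zero-next : ∀ d → d ≤ suc (dist u) → d ≢ 1 → d ≡ 0
    zero-next d d≤ d≢1 rewrite d≡0 = n<1⇒n≡0 (≤∧≢⇒< d≤ d≢1)

  corner : Fin 3 × Fin 3 → Vertex n → Vertex (2 + n)
  corner (x , y) v = x ∷ y ∷ v

  FourReachable : Vertex (2 + n) → Set
  FourReachable v = ∃[ C ] (Unique C × length C ≡ 4 × All (Path v) C)

  four : ∀ {u} v (xys : List (Fin 3 × Fin 3)) → Unique xys → length xys ≡ 4 →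
         All (λ xy → Path u (corner xy v)) xys → FourReachable u
  four v xys unique |xys|≡4 paths =
    map (λ xy → corner xy v) xys ,
    Unique.map⁺ (λ { refl → refl }) unique ,
    trans (length-map _ xys) |xys|≡4 ,
    All.map⁺ paths

  square cross : List (Fin 3 × Fin 3)
  square = (0F , 0F) ∷ (0F , 1F) ∷ (1F , 0F) ∷ (1F , 1F) ∷ []
  cross  = (2F , 2F) ∷ (2F , 0F) ∷ (2F , 1F) ∷ (0F , 2F) ∷ []

  unique-pairs : (xys : List (Fin 3 × Fin 3)) → Dec (Unique xys)
  unique-pairs = unique? (Product.≡-dec Fin._≟_ Fin._≟_)

  -- On the translate of the square through the given vertex, `dist` is constantly `weight v`, so
  -- all of it survives.
  four-square : ∀ {x y v} → isTwo x ≡ false → isTwo y ≡ false → weight v ≢ 1 →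
                FourReachable (x ∷ y ∷ v)
  four-square {x} {y} {v} x≢2 y≢2 w≢1 = four v square (from-yes (unique-pairs square)) refl
    (to 0F 0F refl refl ∷ to 0F 1F refl refl ∷ to 1F 0F refl refl ∷ to 1F 1F refl refl ∷ [])
    where
    good : ∀ x y → isTwo x ≡ false → isTwo y ≡ false → Good (x ∷ y ∷ v)
    good x y x≢2 y≢2 rewrite x≢2 | y≢2 = w≢1
    to : ∀ x′ y′ → isTwo x′ ≡ false → isTwo y′ ≡ false → Path (x ∷ y ∷ v) (x′ ∷ y′ ∷ v)
    to x′ y′ x′≢2 y′≢2 = Walk-trans
      (path-near (good x y x≢2 y≢2) (good x′ y x′≢2 y≢2) (Near-head x x′ (y ∷ v)))
      (path-near (good x′ y x′≢2 y≢2) (good x′ y′ x′≢2 y′≢2) (Near-tail x′ (Near-head y y′ v)))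

  -- With a tail of positive weight, a 2 in one of the first two positions already makes `dist` at
  -- least 2. All five vertices of the cross around `hub` therefore survive, and `cross` lists four
  -- of them.
  module Cross (v : Vertex n) (w>0 : 0 < weight v) where
    hub : Vertex (2 + n)
    hub = 2F ∷ 2F ∷ v

    goodˡ : ∀ y → Good (2F ∷ y ∷ v)
    goodˡ y d≡1 = <⇒≢ (≤-trans w>0 (m≤n+m (weight v) (bit (isTwo y)))) (sym (suc-injective d≡1))

    goodʳ : ∀ x → Good (x ∷ 2F ∷ v)
    goodʳ x d≡1 = <⇒≢ (≤-trans w>0 (m≤n+m (weight v) (bit (isTwo x))))
                    (sym (suc-injective (trans (sym (+-suc (bit (isTwo x)) (weight v))) d≡1)))

    rowˡ : ∀ y y′ → Path (2F ∷ y ∷ v) (2F ∷ y′ ∷ v)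
    rowˡ y y′ = path-near (goodˡ y) (goodˡ y′) (Near-tail 2F (Near-head y y′ v))

    rowʳ : ∀ x x′ → Path (x ∷ 2F ∷ v) (x′ ∷ 2F ∷ v)
    rowʳ x x′ = path-near (goodʳ x) (goodʳ x′) (Near-head x x′ (2F ∷ v))

    four-hub : ∀ {u} → Path u hub → FourReachable u
    four-hub p = four v cross (from-yes (unique-pairs cross)) refl
      (p ∷ Walk-trans p (rowˡ 2F 0F) ∷ Walk-trans p (rowˡ 2F 1F) ∷ Walk-trans p (rowʳ 2F 0F) ∷ [])

open Cross using (rowˡ; rowʳ; four-hub)

four-reachable : ∀ {n} (v : Vertex (3 + n)) → Good v → FourReachable v
four-reachable (0F ∷ 0F ∷ v) good = four-square refl refl good
four-reachable (0F ∷ 1F ∷ v) good = four-square refl refl good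
four-reachable (1F ∷ 0F ∷ v) good = four-square refl refl good
four-reachable (1F ∷ 1F ∷ v) good = four-square refl refl good
-- The tail may be zero, and then the arms of its cross are removed. Moving the third entry to 1
-- leads to a hub whose tail has positive weight; this takes a third coordinate.
four-reachable (2F ∷ 2F ∷ z ∷ v) good = four-hub (1F ∷ v) (s≤s z≤n)
  (path-near good (λ ()) (Near-tail 2F (Near-tail 2F (Near-head z 1F v))))
-- A single 2 contributes 1 to `dist`, so a surviving vertex has a tail of positive weight.
four-reachable (2F ∷ y@0F ∷ v) good = four-hub v w>0 (rowˡ v w>0 y 2F)
  where w>0 = n≢0⇒n>0 (good ∘ cong suc)
four-reachable (2F ∷ y@1F ∷ v) good = four-hub v w>0 (rowˡ v w>0 y 2F)
  where w>0 = n≢0⇒n>0 (good ∘ cong suc)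
four-reachable (x@0F ∷ 2F ∷ v) good = four-hub v w>0 (rowʳ v w>0 x 2F)
  where w>0 = n≢0⇒n>0 (good ∘ cong suc)
four-reachable (x@1F ∷ 2F ∷ v) good = four-hub v w>0 (rowʳ v w>0 x 2F)
  where w>0 = n≢0⇒n>0 (good ∘ cong suc)

weight-0⃗ : ∀ n → weight (replicate n 0F) ≡ 0
weight-0⃗ zero    = refl
weight-0⃗ (suc n) = weight-0⃗ n

-- `near` lies on the 4-cycle and `far` at distance 2, while by `inside` every walk from `near`
-- stays at distance 0.
sphere-cut : ∀ n → IsExtraCut (3 + n) 3 (sphere (1 + n))
sphere-cut n =
  (near , far , ∉-comprehension⁺ (dist≟1 {suc n}) near-good , ∉-comprehension⁺ (dist≟1 {suc n}) (λ ()) ,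
    λ p → contradiction (inside near-0 p) λ ()) ,
  λ v v∉S → four-reachable v (∉-comprehension⁻ (dist≟1 {suc n}) v∉S)
  where
  near far : Vertex (3 + n)
  near = 0F ∷ 0F ∷ replicate _ 0F
  far  = 2F ∷ 2F ∷ replicate _ 0F
  near-0 : dist near ≡ 0
  near-0 = weight-0⃗ n
  near-good : Good near
  near-good d≡1 = contradiction (trans (sym near-0) d≡1) λ ()

theorem3p8 : (n : ℕ) → 3 ≤ n → ExtraConnectivityIs n 3 (8 * n ∸ 12)
theorem3p8 1 (s≤s ())
theorem3p8 2 (s≤s (s≤s ()))
theorem3p8 (suc (suc (suc n))) _ =
  (sphere (1 + n) , sphere-cut n , trans (∣sphere∣ (1 + n)) (sym total)) ,
  λ S cut → m≤n+o⇒m∸n≤o (8 * (3 + n)) 12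
    (subst (8 * (3 + n) ≤_) (+-comm ∣ S ∣ᵥ 12) (cut-lower-bound (2 + n) S cut))
  where
  total : 8 * (3 + n) ∸ 12 ≡ 8 * (1 + n) + 4
  total = trans (cong (_∸ 12) (split-12 n)) (m+n∸m≡n 12 (8 * (1 + n) + 4))
    where
    split-12 : ∀ n → 8 * (3 + n) ≡ 12 + (8 * (1 + n) + 4)
    split-12 = solve-∀
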